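{- Let $A=\{a_i : i\in\mathbb{N}\}\subseteq\mathbb{N}$ be an infinite set of natural numbers such that $a_i<a_{i+1}$ for all $i\in\mathbb{N}$ and $\liminf_{n\to\infty}\frac{a_{n+1}}{a_n}>1$. Then there exists a set $B\subseteq\mathbb{N}$ with density zero, $d(B)=0$, such that $B$ is an additive complement of $A$ in the complement of $A$.
   Context: $\mathbb{N}=\{1,2,3,\dots\}$ is the set of natural numbers. For $A,B\subseteq\mathbb{N}$, $A+B:=\{x+y: x\in A,\ y\in B\}$. A set $B\subseteq\mathbb{N}$ is an additive complement of $A\subseteq\mathbb{N}$ if $\mathbb{N}\setminus(A+B)$ is a finite set. A set $B\subseteq\mathbb{N}$ is an additive complement of $A$ in the complement of $A$ if $B$ is an additive complement of $A$ and $B\cap A=\varnothing$. The density of $B\subseteq\mathbb{N}$ is $d(B)=\lim_{n\to\infty}\frac{|B\cap\{1,\dots,n\}|}{n}$ when this limit exists (i.e. when the corresponding limsup and liminf coincide). -}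

module Defs where

open import Data.Integer.Base using (+_)
open import Data.List.Base using (List; length; filter; applyUpTo)
import Data.List.Membership.Propositional as List
open import Data.Nat.Base using (ℕ; suc; NonZero)
import Data.Nat.Base as ℕ
open import Data.Product.Base using (∃; ∃₂; ∃-syntax; _×_)
open import Data.Rational.Base using (ℚ; 0ℚ; _/_; _-_; ∣_∣; _<_; _≤_)
open import Level using (Level; 0ℓ)
open import Relation.Binary.PropositionalEquality.Core using (_≡_)
open import Relation.Unary using (Pred; Decidable; _∈_; _⊆_; _∖_; _≐_; _⊥_)

private
  variable
    ℓ ℓ₁ ℓ₂ : Level

-- Natural numbers are positive here: sets of natural numbers are predicates
-- on ℕ contained in ℕ⁺, and a sequence (xₙ) indexed by n = 1, 2, 3, … is a
-- function x on ℕ with x n = xₙ₊₁.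

ℕ⁺ : Pred ℕ 0ℓ
ℕ⁺ = NonZero

Range : (ℕ → ℕ) → Pred ℕ 0ℓ
Range a n = ∃[ i ] a i ≡ n

infixl 6 _⊕_

_⊕_ : Pred ℕ ℓ₁ → Pred ℕ ℓ₂ → Pred ℕ _
(A ⊕ B) n = ∃₂ λ x y → x ∈ A × y ∈ B × x ℕ.+ y ≡ n

Finite : Pred ℕ ℓ → Set ℓ
Finite P = ∃[ xs ] P ≐ (List._∈ xs)

_IsAdditiveComplementOf_ : Pred ℕ ℓ₁ → Pred ℕ ℓ₂ → Set _
B IsAdditiveComplementOf A = Finite (ℕ⁺ ∖ (A ⊕ B))

_IsAdditiveComplementInComplementOf_ : Pred ℕ ℓ₁ → Pred ℕ ℓ₂ → Set _
B IsAdditiveComplementInComplementOf A = B IsAdditiveComplementOf A × B ⊥ A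

-- liminf x = sup_N inf_{n ≥ N} xₙ is an extended real, so it is given by its
-- lower cut, the rationals strictly below it.  In particular +∞ is allowed.

infix 4 _<inf_ _<liminf_

_<inf_ : ℚ → (ℕ → ℚ) → Set
q <inf x = ∃[ r ] q < r × (∀ n → r ≤ x n)

_<liminf_ : ℚ → (ℕ → ℚ) → Set
q <liminf x = ∃[ N ] q <inf (λ n → x (N ℕ.+ n))

_⟶_ : (ℕ → ℚ) → ℚ → Set
x ⟶ l = ∀ ε → 0ℚ < ε → ∃[ N ] (∀ n → N ℕ.≤ n → ∣ x n - l ∣ < ε)

-- aₙ₊₁ / aₙ
ratio : (a : ℕ → ℕ) → (∀ n → a n ∈ ℕ⁺) → ℕ → ℚ
ratio a a⁺ n = (+ a (suc n) / a n) {{a⁺ n}}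

-- |B ∩ {1, …, n}|.  Counting needs membership in B to be decidable, which is
-- no restriction classically.
count : {B : Pred ℕ ℓ} → Decidable B → ℕ → ℕ
count B? n = length (filter B? (applyUpTo suc n))

HasDensity : {B : Pred ℕ ℓ} → Decidable B → ℚ → Set
HasDensity B? d = (λ n → + count B? (suc n) / suc n) ⟶ d

{-# OPTIONS --safe #-}

-- Fix m, and let α ∈ (0, 1/m] be such that for each t < m two elements f of A
-- satisfy {fα} ∈ [t/m, (t+1)/m]; such an α = x/y is found by nested intervals,
-- choosing each f large compared with the inverse length of the current
-- interval.  The set C of all b with {bα + 1/m} < 2/m has density O(1/m).  If
-- {nα} lies in [t/m, (t+1)/m), then n - f ∈ C for both f attached to t, so every
-- large n has two representations n = f + b with b ∈ C and bounded f.
-- Lacunarity makes the gaps of A tend to infinity, so the two values of b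
-- cannot both be in A, and C ∖ A already represents every large n.  Letting m
-- grow slowly with b yields a set of density zero.

module Submission where

open import Defs
open import Data.Integer.Base as ℤ using (+_; -[1+_])
import Data.Integer.Properties as ℤ
open import Data.List.Base using (filter; length; applyUpTo; upTo; []; _∷_; _∷ʳ_; _++_)
import Data.List.Membership.Propositional as List
open import Data.List.Membership.Propositional.Properties using (∈-filter⁺; ∈-filter⁻; ∈-upTo⁺)
open import Data.List.Properties
  using (applyUpTo-∷ʳ; filter-++; length-++; length-applyUpTo; length-filter; filter-accept; filter-reject)
open import Data.Nat.Base
open import Data.Nat.DivMod
open import Data.Nat.Properties
open import Data.Nat.Tactic.RingSolver using (solve-∀)
open import Data.Product.Base
open import Data.Rational.Base as ℚ using (ℚ; 0ℚ; 1ℚ; mkℚ; toℚᵘ)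
import Data.Rational.Properties as ℚ
open import Data.Rational.Unnormalised.Base as ℚᵘ using (mkℚᵘ)
import Data.Rational.Unnormalised.Properties as ℚᵘ
open import Data.Sum.Base as Sum using (_⊎_; inj₁; inj₂; [_,_]′)
open import Function.Base using (_∘_; id; case_of_)
open import Level using (Level; 0ℓ)
open import Relation.Binary.PropositionalEquality
open import Relation.Nullary.Decidable using (yes; no; map′; _×-dec_; _⊎-dec_; ¬?)
open import Relation.Nullary.Negation using (¬_; contradiction)
open import Relation.Unary using (Pred; Decidable; _∈_; _∉_; _⊆_; _∪_; _∖_)
open import Relation.Unary.Properties using (_∪?_)

private
  variable
    ℓ ℓ₁ ℓ₂ : Level

-- Strictly increasing sequences

module StrictlyIncreasing (f : ℕ → ℕ) (f< : ∀ i → f i < f (suc i)) where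

  mono-≤ : ∀ {i j} → i ≤ j → f i ≤ f j
  mono-≤ = go ∘ ≤⇒≤′
    where
    go : ∀ {i j} → i ≤′ j → f i ≤ f j
    go ≤′-refl       = ≤-refl
    go (≤′-step i≤j) = ≤-trans (go i≤j) (<⇒≤ (f< _))

  mono-< : ∀ {i j} → i < j → f i < f j
  mono-< i<j = <-≤-trans (f< _) (mono-≤ i<j)

  cancel-< : ∀ {i j} → f i < f j → i < j
  cancel-< fi<fj = ≰⇒> (<⇒≱ fi<fj ∘ mono-≤)

  n≤f[n] : ∀ n → n ≤ f n
  n≤f[n] zero    = z≤n
  n≤f[n] (suc n) = ≤-<-trans (n≤f[n] n) (f< n)

  range? : Decidable (Range f)
  range? n = map′ (λ (i , _ , fi≡n) → i , fi≡n)
                  (λ (i , fi≡n) → i , s≤s (subst (i ≤_) fi≡n (n≤f[n] i)) , fi≡n)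
                  (anyUpTo? (λ i → f i ≟ n) (suc n))

  -- Passing from n to n + 1 crosses at most one breakpoint. This assigns each n to its block when
  -- stages are glued.
  locate : f 0 ≡ 0 → ∀ n → ∃[ k ] f k ≤ n × n < f (suc k)
  locate f0≡0 zero    = 0 , ≤-reflexive f0≡0 , ≤-<-trans z≤n (f< 0)
  locate f0≡0 (suc n) with locate f0≡0 n
  ... | k , fk≤n , n<f[1+k] with f (suc k) ≤? suc n
  ...   | yes f[1+k]≤1+n = suc k , f[1+k]≤1+n , ≤-<-trans n<f[1+k] (f< (suc k))
  ...   | no  f[1+k]≰1+n = k , m≤n⇒m≤1+n fk≤n , ≰⇒> f[1+k]≰1+n

-- Decidable sumsets and counting

⊕? : {P : Pred ℕ ℓ₁} {Q : Pred ℕ ℓ₂} → Decidable P → Decidable Q → Decidable (P ⊕ Q)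
⊕? {Q = Q} P? Q? n = map′ (λ (x , x<1+n , px , q) → x , n ∸ x , px , q , m+[n∸m]≡n (≤-pred x<1+n))
                  (λ { (x , y , px , qy , refl) →
                         x , s≤s (m≤m+n x y) , px , subst Q (sym (m+n∸m≡n x y)) qy })
                  (anyUpTo? (λ x → P? x ×-dec Q? (n ∸ x)) (suc n))

module _ {P : Pred ℕ ℓ} (P? : Decidable P) where

  private
    count-suc : ∀ n → count P? (suc n) ≡ count P? n + length (filter P? (suc n ∷ []))
    count-suc n = begin
      length (filter P? (applyUpTo suc (suc n)))             ≡⟨ cong (length ∘ filter P?) (applyUpTo-∷ʳ suc n) ⟨
      length (filter P? (applyUpTo suc n ∷ʳ suc n))          ≡⟨ cong length (filter-++ P? (applyUpTo suc n) _) ⟩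
      length (filter P? (applyUpTo suc n) ++ filter P? (suc n ∷ [])) ≡⟨ length-++ (filter P? (applyUpTo suc n)) ⟩
      count P? n + length (filter P? (suc n ∷ []))           ∎
      where open ≡-Reasoning

  count-accept : ∀ {n} → P (suc n) → count P? (suc n) ≡ suc (count P? n)
  count-accept {n} p = trans (count-suc n)
    (trans (cong (λ xs → count P? n + length xs) (filter-accept P? p)) (+-comm (count P? n) 1))

  count-reject : ∀ {n} → ¬ P (suc n) → count P? (suc n) ≡ count P? n
  count-reject {n} ¬p = trans (count-suc n)
    (trans (cong (λ xs → count P? n + length xs) (filter-reject P? ¬p)) (+-identityʳ (count P? n)))

  count-step : ∀ n → count P? n ≤ count P? (suc n)
  count-step n = ≤-trans (m≤m+n _ _) (≤-reflexive (sym (count-suc n)))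

  count≤n : ∀ n → count P? n ≤ n
  count≤n n = ≤-trans (length-filter P? (applyUpTo suc n)) (≤-reflexive (length-applyUpTo suc n))

-- The cover is asked for only up to n because the stages active in `B` depend on b, and b ≤ n
-- limits which of them occur.
count-cover : {P : Pred ℕ ℓ} {Q : Pred ℕ ℓ₁} {R : Pred ℕ ℓ₂}
              (P? : Decidable P) (Q? : Decidable Q) (R? : Decidable R) →
              ∀ n → (∀ {b} → b ≤ n → b ∈ P → b ∈ Q ⊎ b ∈ R) →
              count P? n ≤ count Q? n + count R? n
count-cover P? Q? R? zero    cover = z≤n
count-cover P? Q? R? (suc n) cover with count-cover P? Q? R? n (cover ∘ m≤n⇒m≤1+n) | P? (suc n)
... | ih | no ¬p rewrite count-reject P? ¬p = ≤-trans ih (+-mono-≤ (count-step Q? n) (count-step R? n))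
... | ih | yes p rewrite count-accept P? p with cover ≤-refl p
...   | inj₁ q rewrite count-accept Q? q = s≤s (≤-trans ih (+-monoʳ-≤ _ (count-step R? n)))
...   | inj₂ r rewrite count-accept R? r | +-suc (count Q? (suc n)) (count R? n) =
  s≤s (≤-trans ih (+-monoˡ-≤ _ (count-step Q? n)))

count-<-≤ : ∀ t n → count (_<? t) n ≤ t
count-<-≤ t zero    = z≤n
count-<-≤ t (suc n) with suc n <? t
... | yes 1+n<t = ≤-trans (count≤n (_<? t) (suc n)) (<⇒≤ 1+n<t)
... | no  1+n≮t rewrite count-reject (_<? t) 1+n≮t = count-<-≤ t n

-- Visit counts of a rational rotation

-- The set of b for which the rotation bP/Q + o/Q lands in [0, W/Q) modulo 1.
module Rotation (P Q o W : ℕ) .{{_ : NonZero Q}} (P≤Q : P ≤ Q) where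

  Visits : Pred ℕ 0ℓ
  Visits b = (b * P + o) % Q < W

  visits? : Decidable Visits
  visits? b = (b * P + o) % Q <? W

  remainder : ∀ {x r} k → x ≡ r + k * Q → r < Q → x % Q ≡ r
  remainder {r = r} k refl r<Q = trans ([m+kn]%n≡m%n r k Q) (m<n⇒m%n≡m r<Q)

  -- Write nP + o = φ + kQ.  Passing from n - 1 to n never lowers the potential
  -- k(W + P) + min(φ + P, W + P), and raises it by at least P if n is a visit.
  potential : ∀ n → ∃₂ λ k φ → n * P + o ≡ φ + k * Q × φ < Q ×
              P * count visits? n ≤ k * (W + P) + (φ + P) ⊓ (W + P)
  potential zero = o / Q , o % Q , m≡m%n+[m/n]*n o Q , m%n<n o Q , ≤-trans (≤-reflexive (*-zeroʳ P)) z≤n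
  potential (suc n) with potential n
  ... | k , φ , eq , φ<Q , bound with φ + P <? Q
  ...   | yes φ+P<Q = k , φ + P , eq′ , φ+P<Q , bound′
    where
    eq′ : P + n * P + o ≡ φ + P + k * Q
    eq′ = begin
      P + n * P + o   ≡⟨ +-assoc P (n * P) o ⟩
      P + (n * P + o) ≡⟨ cong (_+_ P) eq ⟩
      P + (φ + k * Q) ≡⟨ +-assoc P φ (k * Q) ⟨
      P + φ + k * Q   ≡⟨ cong (_+ k * Q) (+-comm P φ) ⟩
      φ + P + k * Q   ∎
      where open ≡-Reasoning

    rearrange : ∀ x y z → x + (y + z) ≡ y + (z + x)
    rearrange = solve-∀

    open ≤-Reasoning
    bound′ : P * count visits? (suc n) ≤ k * (W + P) + (φ + P + P) ⊓ (W + P)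
    bound′ = case visits? (suc n) of λ where
      (no ¬v) → begin
        P * count visits? (suc n)                      ≡⟨ cong (P *_) (count-reject visits? ¬v) ⟩
        P * count visits? n                            ≤⟨ bound ⟩
        k * (W + P) + (φ + P) ⊓ (W + P)                ≤⟨ +-monoʳ-≤ (k * (W + P)) (⊓-monoˡ-≤ (W + P) (m≤m+n (φ + P) P)) ⟩
        k * (W + P) + (φ + P + P) ⊓ (W + P)            ∎
      (yes v) → begin
        P * count visits? (suc n)                      ≡⟨ cong (P *_) (count-accept visits? v) ⟩
        P * suc (count visits? n)                      ≡⟨ *-suc P (count visits? n) ⟩
        P + P * count visits? n                        ≤⟨ +-monoʳ-≤ P bound ⟩
        P + (k * (W + P) + (φ + P) ⊓ (W + P))          ≤⟨ +-monoʳ-≤ P (+-monoʳ-≤ (k * (W + P)) (m⊓n≤m _ _)) ⟩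
        P + (k * (W + P) + (φ + P))                    ≡⟨ rearrange P (k * (W + P)) (φ + P) ⟩
        k * (W + P) + (φ + P + P)
          -- A visit means φ + P < W, so the new minimum is not capped and exceeds the old one by at
          -- least P.
          ≡⟨ cong (_+_ (k * (W + P))) (m≤n⇒m⊓n≡m (+-monoˡ-≤ P (<⇒≤ (subst (_< W) (remainder k eq′ φ+P<Q) v)))) ⟨
        k * (W + P) + (φ + P + P) ⊓ (W + P)            ∎
  ...   | no φ+P≮Q = suc k , φ + P ∸ Q , eq′ , φ′<Q , bound′
    where
    Q≤φ+P : Q ≤ φ + P
    Q≤φ+P = ≮⇒≥ φ+P≮Q

    eq′ : P + n * P + o ≡ φ + P ∸ Q + (Q + k * Q)
    eq′ = begin
      P + n * P + o                 ≡⟨ +-assoc P (n * P) o ⟩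
      P + (n * P + o)               ≡⟨ cong (_+_ P) eq ⟩
      P + (φ + k * Q)               ≡⟨ +-assoc P φ (k * Q) ⟨
      P + φ + k * Q                 ≡⟨ cong (_+ k * Q) (+-comm P φ) ⟩
      φ + P + k * Q                 ≡⟨ cong (_+ k * Q) (m∸n+n≡m Q≤φ+P) ⟨
      φ + P ∸ Q + Q + k * Q         ≡⟨ +-assoc (φ + P ∸ Q) Q (k * Q) ⟩
      φ + P ∸ Q + (Q + k * Q)       ∎
      where open ≡-Reasoning

    φ′<Q : φ + P ∸ Q < Q
    φ′<Q = m<n+o⇒m∸n<o (φ + P) Q (+-mono-<-≤ φ<Q P≤Q)

    open ≤-Reasoning
    -- The completed turn adds W + P, which repays the old minimum; the new minimum is at least P,
    -- enough for one more visit.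
    bound′ : P * count visits? (suc n) ≤ W + P + k * (W + P) + (φ + P ∸ Q + P) ⊓ (W + P)
    bound′ = begin
      P * count visits? (suc n)                   ≤⟨ *-monoʳ-≤ P count≤ ⟩
      P * suc (count visits? n)                   ≡⟨ *-suc P (count visits? n) ⟩
      P + P * count visits? n                     ≤⟨ +-monoʳ-≤ P bound ⟩
      P + (k * (W + P) + (φ + P) ⊓ (W + P))       ≤⟨ +-monoʳ-≤ P (+-monoʳ-≤ (k * (W + P)) (m⊓n≤n _ _)) ⟩
      P + (k * (W + P) + (W + P))                 ≡⟨ rearrange P (k * (W + P)) (W + P) ⟩
      W + P + k * (W + P) + P                     ≤⟨ +-monoʳ-≤ (W + P + k * (W + P)) (⊓-glb (m≤n+m P _) (m≤n+m P W)) ⟩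
      W + P + k * (W + P) + (φ + P ∸ Q + P) ⊓ (W + P) ∎
      where
      rearrange : ∀ x y z → x + (y + z) ≡ z + y + x
      rearrange = solve-∀
      count≤ : count visits? (suc n) ≤ suc (count visits? n)
      count≤ = case visits? (suc n) of λ where
        (yes v) → ≤-reflexive (count-accept visits? v)
        (no ¬v) → ≤-trans (≤-reflexive (count-reject visits? ¬v)) (n≤1+n _)

  -- The potential allows W/P + 1 visits per turn of the circle and at most (nP + o)/Q + 1 turns;
  -- the denominators P and Q are cleared.
  count-visits : ∀ n → P * count visits? n * Q ≤ (W + P) * (n * P + o + Q)
  count-visits n with potential n
  ... | k , φ , eq , _ , bound = begin
    P * count visits? n * Q                        ≤⟨ *-monoˡ-≤ Q bound ⟩
    (k * (W + P) + (φ + P) ⊓ (W + P)) * Q          ≤⟨ *-monoˡ-≤ Q (+-monoʳ-≤ (k * (W + P)) (m⊓n≤n _ _)) ⟩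
    (k * (W + P) + (W + P)) * Q                    ≡⟨ rearrange k (W + P) Q ⟩
    (W + P) * (k * Q + Q)                          ≤⟨ *-monoʳ-≤ (W + P) (+-monoˡ-≤ Q (m≤n+m (k * Q) φ)) ⟩
    (W + P) * (φ + k * Q + Q)                      ≡⟨ cong (λ x → (W + P) * (x + Q)) eq ⟨
    (W + P) * (n * P + o + Q)                      ∎
    where
    open ≤-Reasoning
    rearrange : ∀ k w q → (k * w + w) * q ≡ w * (k * q + q)
    rearrange = solve-∀

-- Ratios and densities in integer terms

toℚᵘ-/ : ∀ p d → toℚᵘ (+ p ℚ./ suc d) ℚᵘ.≃ mkℚᵘ (+ p) d
toℚᵘ-/ p d = ℚ.toℚᵘ-fromℚᵘ (mkℚᵘ (+ p) d)

-- r = num/den > 1 gives num ≥ den + 1.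
1<r≤m/n⇒gap : ∀ {r} m n .{{_ : NonZero n}} → 1ℚ ℚ.< r → r ℚ.≤ + m ℚ./ n →
              suc (ℚ.denominatorℕ r) * n ≤ m * ℚ.denominatorℕ r
1<r≤m/n⇒gap {mkℚ (+ num) d-1 _} m (suc n-1) (ℚ.*<* 1<r) r≤m/n
  with ℚᵘ.≤-respʳ-≃ (toℚᵘ-/ m n-1) (ℚ.toℚᵘ-mono-≤ r≤m/n)
... | ℚᵘ.*≤* le = ≤-trans (*-monoˡ-≤ (suc n-1) d<num) num*n≤m*d
  where
  d<num : suc d-1 < num
  d<num = subst₂ _<_ (+-identityʳ _) (*-identityʳ num)
    (ℤ.drop‿+<+ (subst₂ ℤ._<_ (sym (ℤ.pos-* 1 (suc d-1))) (sym (ℤ.pos-* num 1)) 1<r))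
  num*n≤m*d : num * suc n-1 ≤ m * suc d-1
  num*n≤m*d = ℤ.drop‿+≤+ (subst₂ ℤ._≤_ (sym (ℤ.pos-* num (suc n-1))) (sym (ℤ.pos-* m (suc d-1))) le)
1<r≤m/n⇒gap {mkℚ -[1+ _ ] _ _} m n (ℚ.*<* ()) _

-- The threshold is on the value `a k`, not the index k, since `escape` knows elements of A by their
-- size.
Gapped : (ℕ → ℕ) → Set
Gapped a = ∀ D → ∃[ N ] (∀ k → N ≤ a k → a k + D < a (suc k))

-- If r > 1 has denominator d, a ratio of at least r makes the gap after `a k` at least `a k`/d,
-- which exceeds D once `a k` > Dd. The term `a N` in the threshold forces k ≥ N, where the ratio
-- bound holds.
lacunary⇒gapped : ∀ a (a⁺ : ∀ i → a i ∈ ℕ⁺) → (∀ i → a i < a (suc i)) →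
                  1ℚ <liminf ratio a a⁺ → Gapped a
lacunary⇒gapped a a⁺ a< (N , r , 1<r , r≤ratio) D = suc (a N + D * d) , gap
  where
  open StrictlyIncreasing a a<
  d = ℚ.denominatorℕ r
  gap : ∀ k → suc (a N + D * d) ≤ a k → a k + D < a (suc k)
  gap k large = *-cancelʳ-< d _ _ (begin-strict
    (a k + D) * d      ≡⟨ *-distribʳ-+ d (a k) D ⟩
    a k * d + D * d    <⟨ +-monoʳ-< (a k * d) (≤-<-trans (m≤n+m (D * d) (a N)) large) ⟩
    a k * d + a k      ≡⟨ +-comm (a k * d) (a k) ⟩
    a k + a k * d      ≡⟨ cong (_+_ (a k)) (*-comm (a k) d) ⟩
    suc d * a k        ≤⟨ 1<r≤m/n⇒gap (a (suc k)) (a k) {{a⁺ k}} 1<r r≤ratio[k] ⟩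
    a (suc k) * d      ∎)
    where
    open ≤-Reasoning
    N≤k : N ≤ k
    N≤k = <⇒≤ (cancel-< (≤-<-trans (m≤m+n (a N) (D * d)) large))
    r≤ratio[k] : r ℚ.≤ ratio a a⁺ k
    r≤ratio[k] = subst (λ j → r ℚ.≤ ratio a a⁺ j) (m+[n∸m]≡n N≤k) (r≤ratio (k ∸ N))

-- A positive rational is at least the reciprocal of its denominator.
c*d<n⇒∣c/n∣<ε : ∀ {ε} c n → 0ℚ ℚ.< ε → c * ℚ.denominatorℕ ε < suc n →
                ℚ.∣ + c ℚ./ suc n ℚ.- 0ℚ ∣ ℚ.< ε
c*d<n⇒∣c/n∣<ε {ε@(mkℚ (+ suc p) d-1 _)} c n _ small = subst (ℚ._< ε) (sym abs) c/n<ε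
  where
  abs : ℚ.∣ + c ℚ./ suc n ℚ.- 0ℚ ∣ ≡ + c ℚ./ suc n
  abs = trans (cong ℚ.∣_∣ (ℚ.+-identityʳ (+ c ℚ./ suc n)))
              (ℚ.0≤p⇒∣p∣≡p (ℚ.nonNegative⁻¹ _ {{ℚ.normalize-nonNeg c (suc n)}}))
  c/n<ε : + c ℚ./ suc n ℚ.< ε
  c/n<ε = ℚ.toℚᵘ-cancel-< (ℚᵘ.<-respˡ-≃ (ℚᵘ.≃-sym (toℚᵘ-/ c n)) (ℚᵘ.*<*
    (subst₂ ℤ._<_ (ℤ.pos-* c (suc d-1)) (ℤ.pos-* (suc p) (suc n))
      (ℤ.+<+ (<-≤-trans small (m≤m+n (suc n) (p * suc n)))))))
c*d<n⇒∣c/n∣<ε {mkℚ (+ zero)   _ _} _ _ (ℚ.*<* (ℤ.+<+ ()))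
c*d<n⇒∣c/n∣<ε {mkℚ -[1+ _ ] _ _} _ _ (ℚ.*<* ())

density-zero : {B : Pred ℕ ℓ} (B? : Decidable B) →
               (∀ d → ∃[ N ] (∀ n → N ≤ n → 0 < n → count B? n * d < n)) → HasDensity B? 0ℚ
density-zero B? sparse ε 0<ε with sparse (ℚ.denominatorℕ ε)
... | N , small = N , λ n N≤n → c*d<n⇒∣c/n∣<ε (count B? (suc n)) n 0<ε (small (suc n) (m≤n⇒m≤1+n N≤n) z<s)

-- Steering by nested intervals

-- t/m ≤ fα ≤ (t+1)/m modulo 1, for every α in [x/y, (x+1)/y]
record Steers (m t x y f : ℕ) : Set where
  constructor steers
  field
    turns : ℕ
    lower : (m * turns + t) * y ≤ m * f * x
    upper : m * f * suc x ≤ suc (m * turns + t) * y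

-- [x′/y′, (x′+1)/y′] ⊆ [x/y, (x+1)/y]
record _⊑_ (I′ I : ℕ × ℕ) : Set where
  constructor nested
  field
    lower : proj₁ I * proj₂ I′ ≤ proj₁ I′ * proj₂ I
    upper : suc (proj₁ I′) * proj₂ I ≤ suc (proj₁ I) * proj₂ I′

private
  swap₃ : ∀ x y z → x * y * z ≡ x * z * y
  swap₃ = solve-∀

  -- Transitivity of x/y ≤ u/v ≤ z/w with denominators cleared.
  chain : ∀ {x u y v z w} .{{_ : NonZero v}} → x * v ≤ u * y → u * w ≤ z * v → x * w ≤ z * y
  chain {x} {u} {y} {v} {z} {w} xv≤uy uw≤zv = *-cancelʳ-≤ (x * w) (z * y) v (begin
    x * w * v ≡⟨ swap₃ x w v ⟩
    x * v * w ≤⟨ *-monoˡ-≤ w xv≤uy ⟩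
    u * y * w ≡⟨ swap₃ u y w ⟩
    u * w * y ≤⟨ *-monoˡ-≤ y uw≤zv ⟩
    z * v * y ≡⟨ swap₃ z v y ⟩
    z * y * v ∎)
    where open ≤-Reasoning

⊑-trans : ∀ {x y u v z w} .{{_ : NonZero v}} → (x , y) ⊑ (u , v) → (u , v) ⊑ (z , w) → (x , y) ⊑ (z , w)
⊑-trans {x} {y} {u} {v} {z} {w} (nested p q) (nested p′ q′) =
  nested (chain {z} {u} {w} {v} {x} {y} p′ p) (chain {suc x} {suc u} {y} {v} {suc z} {w} q q′)

-- Bounds on fα over an interval persist on subintervals, so arcs already treated stay treated as α
-- is refined.
steers-⊑ : ∀ {m t x y x′ y′ f} .{{_ : NonZero y}} → (x′ , y′) ⊑ (x , y) →
           Steers m t x y f → Steers m t x′ y′ f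
steers-⊑ {m} {t} {x} {y} {x′} {y′} {f} (nested p q) (steers c lower upper) = steers c
  (*-cancelʳ-≤ _ _ y (begin
    (m * c + t) * y′ * y ≡⟨ swap₃ (m * c + t) y′ y ⟩
    (m * c + t) * y * y′ ≤⟨ *-monoˡ-≤ y′ lower ⟩
    m * f * x * y′       ≡⟨ *-assoc (m * f) x y′ ⟩
    m * f * (x * y′)     ≤⟨ *-monoʳ-≤ (m * f) p ⟩
    m * f * (x′ * y)     ≡⟨ *-assoc (m * f) x′ y ⟨
    m * f * x′ * y       ∎))
  (*-cancelʳ-≤ _ _ y (begin
    m * f * suc x′ * y         ≡⟨ *-assoc (m * f) (suc x′) y ⟩
    m * f * (suc x′ * y)       ≤⟨ *-monoʳ-≤ (m * f) q ⟩
    m * f * (suc x * y′)       ≡⟨ *-assoc (m * f) (suc x) y′ ⟨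
    m * f * suc x * y′         ≤⟨ *-monoˡ-≤ y′ upper ⟩
    suc (m * c + t) * y * y′   ≡⟨ swap₃ (suc (m * c + t)) y y′ ⟩
    suc (m * c + t) * y′ * y   ∎))
  where open ≤-Reasoning

-- As α runs over an interval of length 1/y and f ≥ 2y, fα covers a full unit
-- interval [c, c+1].
steer : ∀ m t x y f .{{_ : NonZero y}} → t < m → 2 * y ≤ f →
        ∃[ x′ ] (x′ , m * f) ⊑ (x , y) × Steers m t x′ (m * f) f × NonZero x′
steer m t x y f t<m 2y≤f = m * c + t , nested lower upper ,
  steers c (≤-reflexive (*-comm _ (m * f))) (≤-reflexive (*-comm (m * f) _)) , x′≢0
  where
  open ≤-Reasoning
  -- The next integer above fx/y. Across the interval fα grows by f/y ≥ 2 and so reaches c + 1; the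
  -- new interval is where m(fα - c) lies in [t, t + 1].
  c = suc (f * x / y)

  fx<cy : f * x < c * y
  fx<cy = begin-strict
    f * x                         ≡⟨ m≡m%n+[m/n]*n (f * x) y ⟩
    f * x % y + f * x / y * y     <⟨ +-monoˡ-< (f * x / y * y) (m%n<n (f * x) y) ⟩
    c * y                         ∎

  lower : x * (m * f) ≤ (m * c + t) * y
  lower = begin
    x * (m * f)     ≡⟨ r x m f ⟩
    m * (f * x)     ≤⟨ *-monoʳ-≤ m (<⇒≤ fx<cy) ⟩
    m * (c * y)     ≡⟨ *-assoc m c y ⟨
    m * c * y       ≤⟨ *-monoˡ-≤ y (m≤m+n (m * c) t) ⟩
    (m * c + t) * y ∎
    where
    r : ∀ x m f → x * (m * f) ≡ m * (f * x)
    r = solve-∀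

  upper : suc (m * c + t) * y ≤ suc x * (m * f)
  upper = begin
    suc (m * c + t) * y           ≡⟨ cong (_* y) (+-suc (m * c) t) ⟨
    (m * c + suc t) * y           ≤⟨ *-monoˡ-≤ y (+-monoʳ-≤ (m * c) t<m) ⟩
    (m * c + m) * y               ≡⟨ r₁ m (f * x / y) y ⟩
    m * (f * x / y * y + 2 * y)   ≤⟨ *-monoʳ-≤ m (+-mono-≤ (m/n*n≤m (f * x) y) 2y≤f) ⟩
    m * (f * x + f)               ≡⟨ r₂ m f x ⟩
    suc x * (m * f)               ∎
    where
    r₁ : ∀ m z y → (m * suc z + m) * y ≡ m * (z * y + 2 * y)
    r₁ = solve-∀
    r₂ : ∀ m f x → m * (f * x + f) ≡ suc x * (m * f)
    r₂ = solve-∀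

  x′≢0 : NonZero (m * c + t)
  x′≢0 = >-nonZero (<-≤-trans (≤-<-trans z≤n t<m) (≤-trans (m≤m*n m c) (m≤m+n (m * c) t)))


-- Covering sets of small density

-- The single constant `D` is the threshold for n, the bound on the summand from A and the error in
-- the count. For k > 0, `C` has upper density at most 3/k.
record Stage (A : Pred ℕ 0ℓ) (k : ℕ) : Set₁ where
  field
    C      : Pred ℕ 0ℓ
    C?     : Decidable C
    D      : ℕ
    covers : ∀ n → D ≤ n → ∃₂ λ x b → x ∈ A × b ∈ C × b ∉ A × x + b ≡ n × n ≤ b + D
    sparse : ∀ n → k * count C? n ≤ 3 * n + D


-- If {nα} ∈ [t/m, (t+1)/m) and {fα} ∈ [t/m, (t+1)/m], then {(n-f)α + 1/m} < 2/m.
steers⇒visits : ∀ {m t x y f b n s k} .{{_ : NonZero (m * y)}} → 2 ≤ m → Steers m t x y f → f + b ≡ n →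
                n * (m * x) ≡ s + t * y + k * (m * y) → s < y →
                (b * (m * x) + y) % (m * y) < 2 * y
steers⇒visits {m} {t} {x} {y} {f} {b} {_} {s} {k} 2≤m (steers c lower upper) refl nα s<y =
  subst (_< 2 * y) (sym rem) s+w<2y
  where
  -- In units of 1/(my), s and u are the offsets of nα and fα from the start t/m of their common
  -- arc, so bα + 1/m becomes s - u + y = s + w modulo my.
  u = m * f * x ∸ (m * c + t) * y
  fα : (m * c + t) * y + u ≡ m * f * x
  fα = m+[n∸m]≡n lower

  u≤y : u ≤ y
  u≤y = m≤n+o⇒m∸n≤o (m * f * x) ((m * c + t) * y) (begin
    m * f * x               ≤⟨ *-monoʳ-≤ (m * f) (n≤1+n x) ⟩
    m * f * suc x           ≤⟨ upper ⟩
    y + (m * c + t) * y     ≡⟨ +-comm y _ ⟩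
    (m * c + t) * y + y     ∎)
    where open ≤-Reasoning

  w = y ∸ u

  s+w<2y : s + w < 2 * y
  s+w<2y = subst (s + w <_) (cong (_+_ y) (sym (+-identityʳ y))) (+-mono-<-≤ s<y (m∸n≤m y u))

  eq : b * (m * x) + y + c * (m * y) ≡ s + w + k * (m * y)
  eq = +-cancelʳ-≡ (u + t * y) _ _ (begin
    b * (m * x) + y + c * (m * y) + (u + t * y)   ≡⟨ r₁ b m x y c u t ⟩
    b * (m * x) + ((m * c + t) * y + u) + y       ≡⟨ cong (λ z → b * (m * x) + z + y) fα ⟩
    b * (m * x) + m * f * x + y                   ≡⟨ r₂ b m x f y ⟩
    (f + b) * (m * x) + y                         ≡⟨ cong₂ _+_ nα (sym (m+[n∸m]≡n u≤y)) ⟩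
    s + t * y + k * (m * y) + (u + w)             ≡⟨ r₃ s (t * y) (k * (m * y)) u w ⟩
    s + w + k * (m * y) + (u + t * y)             ∎)
    where
    open ≡-Reasoning
    r₁ : ∀ b m x y c u t → b * (m * x) + y + c * (m * y) + (u + t * y) ≡
                           b * (m * x) + ((m * c + t) * y + u) + y
    r₁ = solve-∀
    r₂ : ∀ b m x f y → b * (m * x) + m * f * x + y ≡ (f + b) * (m * x) + y
    r₂ = solve-∀
    r₃ : ∀ s p q u w → s + p + q + (u + w) ≡ s + w + q + (u + p)
    r₃ = solve-∀

  rem : (b * (m * x) + y) % (m * y) ≡ s + w
  rem = begin
    (b * (m * x) + y) % (m * y)                 ≡⟨ [m+kn]%n≡m%n _ c (m * y) ⟨
    (b * (m * x) + y + c * (m * y)) % (m * y)   ≡⟨ cong (_% (m * y)) eq ⟩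
    (s + w + k * (m * y)) % (m * y)             ≡⟨ [m+kn]%n≡m%n (s + w) k (m * y) ⟩
    (s + w) % (m * y)                           ≡⟨ m<n⇒m%n≡m (<-≤-trans s+w<2y (*-monoˡ-≤ y 2≤m)) ⟩
    s + w                                       ∎
    where open ≡-Reasoning

module Stages (a : ℕ → ℕ) (a< : ∀ i → a i < a (suc i)) (gapped : Gapped a) where
  open StrictlyIncreasing a a<

  SteeredTwice : (m t x y D : ℕ) → Set
  SteeredTwice m t x y D = ∃₂ λ i j → i < j × a j ≤ D × Steers m t x y (a i) × Steers m t x y (a j)

  -- Since `a i` ≥ i, index `2 * y` supplies an element large enough for `steer`, and index `2 * y₁`
  -- does so again for the refined interval.
  steer-twice : ∀ m t x y .{{_ : NonZero y}} → t < m →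
    ∃₂ λ x′ y′ → ∃[ D ] NonZero x′ × NonZero y′ × (x′ , y′) ⊑ (x , y) × SteeredTwice m t x′ y′ D
  steer-twice m t x y t<m
    with steer m t x y (a (2 * y)) t<m (n≤f[n] (2 * y))
  ... | x₁ , ⊑₁ , steers₁ , _ = x₂ , y₂ , a j , x₂≢0 , y₂≢0 , ⊑-trans ⊑₂ ⊑₁ ,
        i , j , i<j , ≤-refl , steers-⊑ ⊑₂ steers₁ , proj₁ (proj₂ (proj₂ second))
    where
    i = 2 * y
    y₁ = m * a i
    instance
      m≢0 : NonZero m
      m≢0 = >-nonZero (≤-<-trans z≤n t<m)
      ai≢0 : NonZero (a i)
      ai≢0 = >-nonZero (<-≤-trans (>-nonZero⁻¹ i {{m*n≢0 2 y}}) (n≤f[n] i))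
      y₁≢0 : NonZero y₁
      y₁≢0 = m*n≢0 m (a i)
    j = 2 * y₁
    y₂ = m * a j
    i<j : i < j
    i<j = ≤-<-trans (≤-trans (n≤f[n] i) (m≤n*m (a i) m))
      (m<m+n y₁ (>-nonZero⁻¹ (y₁ + 0) {{subst NonZero (sym (+-identityʳ y₁)) y₁≢0}}))
    second = steer m t x₁ y₁ (a j) t<m (n≤f[n] j)
    x₂ = proj₁ second
    ⊑₂ = proj₁ (proj₂ second)
    x₂≢0 = proj₂ (proj₂ (proj₂ second))
    y₂≢0 : NonZero y₂
    y₂≢0 = m*n≢0 m (a j) {{m≢0}} {{>-nonZero (≤-<-trans z≤n (mono-< i<j))}}

  steer-all : ∀ m s .{{_ : NonZero m}} → s ≤ m →
    ∃₂ λ x y → ∃[ D ] NonZero x × NonZero y × (x , y) ⊑ (1 , 2 * m) ×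
    (∀ t → t < s → SteeredTwice m t x y D)
  -- The upper end 2/(2m) forces α ≤ 1/m, so a rotation step is no longer than an arc; the lower end
  -- 1/(2m) keeps α positive.
  steer-all m zero    _   = 1 , 2 * m , 0 , _ , m*n≢0 2 m , nested ≤-refl ≤-refl , λ _ ()
  steer-all m (suc s) s<m with steer-all m s (<⇒≤ s<m)
  ... | x , y , D , _ , y≢0 , ⊑₀ , steered with steer-twice m s x y {{y≢0}} s<m
  ... | x′ , y′ , D′ , x′≢0 , y′≢0 , ⊑₁ , (i , j , i<j , aj≤D′ , steersᵢ , steersⱼ) =
    x′ , y′ , D ⊔ D′ , x′≢0 , y′≢0 , ⊑-trans {{y≢0}} ⊑₁ ⊑₀ , steered′
    where
    steered′ : ∀ t → t < suc s → SteeredTwice m t x′ y′ (D ⊔ D′)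
    steered′ t t<1+s with m≤n⇒m<n∨m≡n (≤-pred t<1+s)
    ... | inj₂ refl = i , j , i<j , ≤-trans aj≤D′ (m≤n⊔m D D′) , steersᵢ , steersⱼ
    ... | inj₁ t<s with steered t t<s
    ...   | i′ , j′ , i′<j′ , aj≤D , steersᵢ′ , steersⱼ′ =
      i′ , j′ , i′<j′ , ≤-trans aj≤D (m≤m⊔n D D′) ,
      steers-⊑ {{y≢0}} ⊑₁ steersᵢ′ , steers-⊑ {{y≢0}} ⊑₁ steersⱼ′

  -- n - aᵢ and n - aⱼ are close together, so gaps longer than aⱼ keep them from both being in A.
  escape : ∀ {D N n i j} → (∀ k → N ≤ a k → a k + D < a (suc k)) → i < j → a j ≤ D → N + D ≤ n →
           n ∸ a i ∉ Range a ⊎ n ∸ a j ∉ Range a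
  escape {D} {N} {n} {i} {j} gap i<j aj≤D N+D≤n with range? (n ∸ a i) | range? (n ∸ a j)
  ... | no ∉A | _      = inj₁ ∉A
  ... | yes _ | no ∉A  = inj₂ ∉A
  ... | yes (u , au≡) | yes (v , av≡) = contradiction au≤av+D (<⇒≱ (<-≤-trans (gap v N≤av) (mono-≤ (cancel-< av<au))))
    where
    ai<aj = mono-< i<j
    aj≤n : a j ≤ n
    aj≤n = ≤-trans aj≤D (≤-trans (m≤n+m D N) N+D≤n)
    N≤av : N ≤ a v
    N≤av = subst (N ≤_) (sym av≡) (m+n≤o⇒m≤o∸n N (≤-trans (+-monoʳ-≤ N aj≤D) N+D≤n))
    av<au : a v < a u
    av<au = subst₂ _<_ (sym av≡) (sym au≡) (∸-monoʳ-< ai<aj aj≤n)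
    au≤av+D : a u ≤ a v + D
    au≤av+D = begin
      a u               ≡⟨ au≡ ⟩
      n ∸ a i           ≤⟨ m∸n≤m n (a i) ⟩
      n                 ≡⟨ m∸n+n≡m aj≤n ⟨
      n ∸ a j + a j     ≤⟨ +-monoʳ-≤ (n ∸ a j) aj≤D ⟩
      n ∸ a j + D       ≡⟨ cong (_+ D) av≡ ⟨
      a v + D           ∎
      where open ≤-Reasoning

  module Construction (k m : ℕ) (2≤m : 2 ≤ m) (k≤m : k ≤ m) (x y D : ℕ) .{{_ : NonZero x}} .{{_ : NonZero y}}
    (α≤1/m : suc x * (2 * m) ≤ 2 * y) (steered : ∀ t → t < m → SteeredTwice m t x y D) where

    P = m * x
    Q = m * y
    instance
      m≢0 : NonZero m
      m≢0 = >-nonZero (<-≤-trans z<s 2≤m)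
      Q≢0 : NonZero Q
      Q≢0 = m*n≢0 m y
    N = proj₁ (gapped D)
    P≤y : P ≤ y
    P≤y = *-cancelˡ-≤ 2 (begin
      2 * (m * x)       ≤⟨ *-monoʳ-≤ 2 (*-monoʳ-≤ m (n≤1+n x)) ⟩
      2 * (m * suc x)   ≡⟨ r m (suc x) ⟩
      suc x * (2 * m)   ≤⟨ α≤1/m ⟩
      2 * y             ∎)
      where
      open ≤-Reasoning
      r : ∀ m x → 2 * (m * x) ≡ x * (2 * m)
      r = solve-∀
    y≤Q : y ≤ Q
    y≤Q = m≤n*m y m
    -- Writing α = x/y as P/Q with Q = my makes 1/m the integer length y: the offset is 1/m and the
    -- window 2/m.
    open Rotation P Q y (2 * y) (≤-trans P≤y y≤Q)

    -- The arc `r / y` containing nα has two steered elements, both giving visits, and by `escape`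
    -- one of the two differences is outside A. The constant joins what `escape` asks of n to the
    -- error `6 * y` of `sparse`.
    covers : ∀ n → N + D + 6 * y ≤ n →
             ∃₂ λ f b → f ∈ Range a × b ∈ Visits × b ∉ Range a × f + b ≡ n × n ≤ b + (N + D + 6 * y)
    covers n n-large = [ use (<⇒≤ (mono-< i<j)) steersᵢ , use ≤-refl steersⱼ ]′ (escape (proj₂ (gapped D)) i<j aj≤D N+D≤n)
      where
      r = n * P % Q
      twice : SteeredTwice m (r / y) x y D
      twice = steered (r / y) (m<n*o⇒m/o<n (m%n<n (n * P) Q))
      i = proj₁ twice
      j = proj₁ (proj₂ twice)
      i<j = proj₁ (proj₂ (proj₂ twice))
      aj≤D = proj₁ (proj₂ (proj₂ (proj₂ twice)))
      steersᵢ = proj₁ (proj₂ (proj₂ (proj₂ (proj₂ twice))))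
      steersⱼ = proj₂ (proj₂ (proj₂ (proj₂ (proj₂ twice))))
      N+D≤n : N + D ≤ n
      N+D≤n = ≤-trans (m≤m+n (N + D) (6 * y)) n-large
      nα : n * P ≡ r % y + r / y * y + n * P / Q * Q
      nα = trans (m≡m%n+[m/n]*n (n * P) Q) (cong (_+ n * P / Q * Q) (m≡m%n+[m/n]*n r y))
      use : ∀ {l} → a l ≤ a j → Steers m (r / y) x y (a l) → n ∸ a l ∉ Range a →
            ∃₂ λ f b → f ∈ Range a × b ∈ Visits × b ∉ Range a × f + b ≡ n × n ≤ b + (N + D + 6 * y)
      use {l} al≤aj steersₗ ∉A = a l , n ∸ a l , (l , refl) ,
        steers⇒visits {m} {k = n * P / Q} 2≤m steersₗ al+b≡n nα (m%n<n r y) , ∉A , al+b≡n , n≤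
        where
        al≤D = ≤-trans al≤aj aj≤D
        al+b≡n : a l + (n ∸ a l) ≡ n
        al+b≡n = m+[n∸m]≡n (≤-trans al≤D (≤-trans (m≤n+m D N) N+D≤n))
        n≤ : n ≤ n ∸ a l + (N + D + 6 * y)
        n≤ = begin
          n                               ≡⟨ al+b≡n ⟨
          a l + (n ∸ a l)                 ≡⟨ +-comm (a l) _ ⟩
          n ∸ a l + a l                   ≤⟨ +-monoʳ-≤ (n ∸ a l) (≤-trans al≤D (≤-trans (m≤n+m D N) (m≤m+n (N + D) (6 * y)))) ⟩
          n ∸ a l + (N + D + 6 * y)       ∎
          where open ≤-Reasoning

    sparse : ∀ n → k * count visits? n ≤ 3 * n + (N + D + 6 * y)
    sparse n = begin
      k * count visits? n        ≤⟨ *-monoˡ-≤ (count visits? n) k≤m ⟩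
      m * count visits? n        ≤⟨ *-cancelʳ-≤ (m * count visits? n) (3 * n + 6 * y) (x * Q) {{m*n≢0 x Q}} bound ⟩
      3 * n + 6 * y              ≤⟨ +-monoʳ-≤ (3 * n) (m≤n+m (6 * y) (N + D)) ⟩
      3 * n + (N + D + 6 * y)    ∎
      where
      open ≤-Reasoning
      bound : m * count visits? n * (x * Q) ≤ (3 * n + 6 * y) * (x * Q)
      bound = begin
        m * count visits? n * (x * Q)       ≡⟨ r₁ m (count visits? n) x Q ⟩
        P * count visits? n * Q             ≤⟨ count-visits n ⟩
        (2 * y + P) * (n * P + y + Q)
          -- P ≤ y bounds the first factor by 3y, and y ≤ Q ≤ xQ bounds both additive terms, so that
          -- xQ can be cancelled.
          ≤⟨ *-mono-≤ (+-monoʳ-≤ (2 * y) P≤y) (+-mono-≤ (+-monoʳ-≤ (n * P) (≤-trans y≤Q Q≤xQ)) Q≤xQ) ⟩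
        (2 * y + y) * (n * P + x * Q + x * Q) ≡⟨ r₂ y n m x ⟩
        (3 * n + 6 * y) * (x * Q)           ∎
        where
        Q≤xQ : Q ≤ x * Q
        Q≤xQ = m≤n*m Q x
        r₁ : ∀ m c x Q → m * c * (x * Q) ≡ m * x * c * Q
        r₁ = solve-∀
        r₂ : ∀ y n m x → (2 * y + y) * (n * (m * x) + x * (m * y) + x * (m * y)) ≡ (3 * n + 6 * y) * (x * (m * y))
        r₂ = solve-∀

    stage : Stage (Range a) k
    stage = record { C = Visits ; C? = visits? ; covers = covers ; sparse = sparse }

  stage-from : ∀ k m → 2 ≤ m → k ≤ m → Stage (Range a) k
  stage-from k m 2≤m k≤m with steer-all m m {{>-nonZero (<-≤-trans z<s 2≤m)}} ≤-refl
  ... | x , y , D , x≢0 , y≢0 , nested _ α≤1/m , steered =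
    Construction.stage k m 2≤m k≤m x y D {{x≢0}} {{y≢0}} α≤1/m steered

  stage : ∀ k → Stage (Range a) k
  stage k = stage-from k (2 + k) (m≤m+n 2 k) (m≤n+m k 2)

-- Gluing the stages into a set of density zero

module Gluing {A : Pred ℕ 0ℓ} (A? : Decidable A) (stage : ∀ k → Stage A k) where
  private
    module S k = Stage (stage k)

  -- The product absorbs k times the count of all b below `T k`; the three `D` terms absorb the
  -- errors of the stages active on blocks k and k + 1.
  T : ℕ → ℕ
  T zero    = 0
  T (suc k) = suc (suc k * T k + (S.D k + S.D (suc k) + S.D (2 + k)))

  T< : ∀ k → T k < T (suc k)
  T< k = s≤s (≤-trans (m≤m+n (T k) (k * T k)) (m≤m+n (suc k * T k) _))

  open StrictlyIncreasing T T<

  σ : ℕ → ℕ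
  σ n = proj₁ (locate refl n)

  T[σ]≤ : ∀ n → T (σ n) ≤ n
  T[σ]≤ n = proj₁ (proj₂ (locate refl n))

  <T[1+σ] : ∀ n → n < T (suc (σ n))
  <T[1+σ] n = proj₂ (proj₂ (locate refl n))

  T≤⇒≤σ : ∀ {k n} → T k ≤ n → k ≤ σ n
  T≤⇒≤σ Tk≤n = ≤-pred (cancel-< (≤-<-trans Tk≤n (<T[1+σ] _)))

  σ-mono-≤ : ∀ {b n} → b ≤ n → σ b ≤ σ n
  σ-mono-≤ b≤n = T≤⇒≤σ (≤-trans (T[σ]≤ _) b≤n)

  -- Keeping the next stage active as well lets n at the start of stage k use
  -- elements b < n of stage k - 1.
  B : Pred ℕ 0ℓ
  B b = NonZero b × b ∉ A × (b ∈ S.C (σ b) ⊎ b ∈ S.C (suc (σ b)))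

  B? : Decidable B
  B? b = nonZero? b ×-dec ¬? (A? b) ×-dec (S.C? (σ b) b ⊎-dec S.C? (suc (σ b)) b)

  -- Such a b lies in block k or k + 1, and stage k + 1 is active in both: as the next stage or as
  -- the current one.
  ∈B : ∀ {k b} → 0 < T k → T k ≤ b → σ b ≤ suc k → b ∉ A → b ∈ S.C (suc k) → b ∈ B
  ∈B {k} {b} 0<T Tk≤b σb≤1+k b∉A b∈C =
    >-nonZero (<-≤-trans 0<T Tk≤b) , b∉A , (case m≤n⇒m<n∨m≡n σb≤1+k of λ where
      (inj₂ σb≡1+k) → inj₁ (subst (λ j → b ∈ S.C j) (sym σb≡1+k) b∈C)
      (inj₁ σb<1+k) → inj₂ (subst (λ j → b ∈ S.C (suc j)) (≤-antisym (T≤⇒≤σ Tk≤b) (≤-pred σb<1+k)) b∈C))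

  T+D≤T : ∀ k → T k + S.D (suc k) ≤ T (suc k)
  T+D≤T k = m≤n⇒m≤1+n (+-mono-≤ (m≤m+n (T k) (k * T k)) (≤-trans (m≤n+m _ (S.D k)) (m≤m+n _ (S.D (2 + k)))))

  covered : ∀ n → T 2 ≤ n → n ∈ A ⊕ B
  covered n T2≤n = go (σ n) refl (T≤⇒≤σ T2≤n)
    where
    go : ∀ j → σ n ≡ j → 2 ≤ j → n ∈ A ⊕ B
    -- Stage k + 1 yields b ≥ n - D ≥ `T k`. From 2 ≤ `σ n` comes k ≥ 1, so `T k` and hence b are
    -- positive.
    go (suc k) σn≡1+k (s≤s 1≤k) with S.covers (suc k) n (≤-trans (m≤n+m _ (T k)) T+D≤n)
      where
      T+D≤n : T k + S.D (suc k) ≤ n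
      T+D≤n = ≤-trans (T+D≤T k) (subst (λ j → T j ≤ n) σn≡1+k (T[σ]≤ n))
    ... | x , b , x∈A , b∈C , b∉A , x+b≡n , n≤b+D =
      x , b , x∈A , ∈B (mono-< 1≤k) Tk≤b (subst (σ b ≤_) σn≡1+k (σ-mono-≤ b≤n)) b∉A b∈C , x+b≡n
      where
      b≤n : b ≤ n
      b≤n = subst (b ≤_) x+b≡n (m≤n+m b x)
      Tk≤b : T k ≤ b
      Tk≤b = +-cancelʳ-≤ (S.D (suc k)) (T k) b
        (≤-trans (≤-trans (T+D≤T k) (subst (λ j → T j ≤ n) σn≡1+k (T[σ]≤ n))) n≤b+D)

  -- Everything below `T k` is counted; from there to n only stages k, k + 1 and k + 2 are active,
  -- each contributing 3n plus its `D`. The remaining constants stay below `T (suc k)` ≤ n, whence 9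
  -- + 1 = 10.
  count-B : ∀ k n → σ n ≡ suc k → k * count B? n ≤ 10 * n
  count-B k n σn≡1+k = begin
    k * count B? n                    ≤⟨ *-monoʳ-≤ k count≤ ⟩
    k * (T k + (c₀ + (c₁ + c₂)))      ≡⟨ expand k (T k) c₀ c₁ c₂ ⟩
    k * T k + (k * c₀ + k * c₁ + k * c₂)
      ≤⟨ +-monoʳ-≤ (k * T k) (+-mono-≤ (+-mono-≤ (S.sparse k n)
           (≤-trans (*-monoˡ-≤ c₁ (m≤n+m k 1)) (S.sparse (suc k) n)))
           (≤-trans (*-monoˡ-≤ c₂ (m≤n+m k 2)) (S.sparse (2 + k) n))) ⟩
    k * T k + (3 * n + S.D k + (3 * n + S.D (suc k)) + (3 * n + S.D (2 + k)))
      ≡⟨ collect (k * T k) n (S.D k) (S.D (suc k)) (S.D (2 + k)) ⟩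
    9 * n + (k * T k + (S.D k + S.D (suc k) + S.D (2 + k)))
      ≤⟨ +-monoʳ-≤ (9 * n) (+-monoˡ-≤ _ (m≤n+m (k * T k) (T k))) ⟩
    9 * n + (suc k * T k + (S.D k + S.D (suc k) + S.D (2 + k)))
      ≤⟨ +-monoʳ-≤ (9 * n) (<⇒≤ (subst (λ j → T j ≤ n) σn≡1+k (T[σ]≤ n))) ⟩
    9 * n + n                         ≡⟨ +-comm (9 * n) n ⟩
    10 * n                            ∎
    where
    open ≤-Reasoning
    c₀ = count (S.C? k) n
    c₁ = count (S.C? (suc k)) n
    c₂ = count (S.C? (2 + k)) n

    expand : ∀ k t x y z → k * (t + (x + (y + z))) ≡ k * t + (k * x + k * y + k * z)
    expand = solve-∀
    collect : ∀ t n x y z → t + (3 * n + x + (3 * n + y) + (3 * n + z)) ≡ 9 * n + (t + (x + y + z))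
    collect = solve-∀

    stages : ∀ {b} → b ≤ n → b ∈ B → b < T k ⊎ (S.C k ∪ (S.C (suc k) ∪ S.C (2 + k))) b
    stages {b} b≤n (_ , _ , active) with b <? T k
    ... | yes b<T = inj₁ b<T
    ... | no  b≮T with m≤n⇒m<n∨m≡n (subst (σ b ≤_) σn≡1+k (σ-mono-≤ b≤n))
    ...   | inj₂ σb≡1+k = inj₂ (inj₂ (subst (λ j → b ∈ S.C j ⊎ b ∈ S.C (suc j)) σb≡1+k active))
    ...   | inj₁ σb<1+k = inj₂ (Sum.map id inj₁
      (subst (λ j → b ∈ S.C j ⊎ b ∈ S.C (suc j)) (≤-antisym (≤-pred σb<1+k) (T≤⇒≤σ (≮⇒≥ b≮T))) active))

    count≤ : count B? n ≤ T k + (c₀ + (c₁ + c₂))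
    count≤ = begin
      count B? n
        ≤⟨ count-cover B? (_<? T k) (S.C? k ∪? (S.C? (suc k) ∪? S.C? (2 + k))) n stages ⟩
      count (_<? T k) n + count (S.C? k ∪? (S.C? (suc k) ∪? S.C? (2 + k))) n
        ≤⟨ +-mono-≤ (count-<-≤ (T k) n) (count-cover _ (S.C? k) (S.C? (suc k) ∪? S.C? (2 + k)) n (λ _ → id)) ⟩
      T k + (c₀ + count (S.C? (suc k) ∪? S.C? (2 + k)) n)
        ≤⟨ +-monoʳ-≤ (T k) (+-monoʳ-≤ c₀ (count-cover _ (S.C? (suc k)) (S.C? (2 + k)) n (λ _ → id))) ⟩
      T k + (c₀ + (c₁ + c₂)) ∎

  B-sparse : ∀ d → ∃[ N ] (∀ n → N ≤ n → 0 < n → count B? n * d < n)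
  -- One more than the 10 of `count-B`: for k ≥ 11d, 11d times the count is at most 10n, strictly
  -- below 11n.
  B-sparse d = T (suc (11 * d)) , λ n T≤n 0<n → go n 0<n (σ n) refl (T≤⇒≤σ T≤n)
    where
    go : ∀ n → 0 < n → ∀ j → σ n ≡ j → suc (11 * d) ≤ j → count B? n * d < n
    go n 0<n (suc k) σn≡1+k (s≤s 11d≤k) = *-cancelˡ-< 11 _ _ (begin-strict
      11 * (count B? n * d)   ≡⟨ r (count B? n) d ⟩
      11 * d * count B? n     ≤⟨ *-monoˡ-≤ (count B? n) 11d≤k ⟩
      k * count B? n          ≤⟨ count-B k n σn≡1+k ⟩
      10 * n                  <⟨ m<n+m (10 * n) 0<n ⟩
      11 * n                  ∎)
      where
      open ≤-Reasoning
      r : ∀ c d → 11 * (c * d) ≡ 11 * d * c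
      r = solve-∀

theorem2p1 : (a : ℕ → ℕ) (a⁺ : ∀ i → a i ∈ ℕ⁺) →
    (∀ i → a i < a (suc i)) →
    1ℚ <liminf ratio a a⁺ →
    Σ[ B ∈ Pred ℕ 0ℓ ] Σ[ B? ∈ Decidable B ]
    B ⊆ ℕ⁺ ×
    HasDensity B? 0ℚ ×
    B IsAdditiveComplementInComplementOf Range a
theorem2p1 a a⁺ a< lacunary =
  B , B? , proj₁ , density-zero B? B-sparse ,
  -- `Finite` asks for a list of exactly the exceptions, so the candidates below `T 2` are filtered.
  (filter missing? (upTo (T 2)) , missing⇒∈ , proj₂ ∘ ∈-filter⁻ missing? {xs = upTo (T 2)}) ,
  λ ((_ , b∉A , _) , b∈A) → b∉A b∈A
  where
  open StrictlyIncreasing a a< using (range?)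
  open Gluing range? (Stages.stage a a< (lacunary⇒gapped a a⁺ a< lacunary))

  missing? : Decidable (ℕ⁺ ∖ (Range a ⊕ B))
  missing? n = nonZero? n ×-dec ¬? (⊕? range? B? n)

  missing⇒∈ : ∀ {n} → n ∈ ℕ⁺ ∖ (Range a ⊕ B) → n List.∈ filter missing? (upTo (T 2))
  missing⇒∈ {n} missing@(_ , uncovered) =
    ∈-filter⁺ missing? (∈-upTo⁺ (≰⇒> (uncovered ∘ covered n))) missing
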